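{- There is a family $\{t_n\}_{n\in\mathbb N}$ of closed $\lambda$-terms such that there is a complete evaluation $\rho_n:t_n\to_{wh}^{n}u_n$ simulated by Naive KAM runs $\sigma_n$ taking both space and time at least exponential in $n$, that is, $|\sigma_n|_{\mathsf{sp}}=|\sigma_n|_{\mathsf{tm}}=\Omega(2^n)$ (both quantities are $\Omega(2^n)$).
   Context: **$\lambda$-terms.** $t,u::=x\mid\lambda x.t\mid t\,u$, up to $\alpha$-equivalence; $|t|$ is the number of constructors. Weak head reduction: $(\lambda x.t)\,u\,r_1\cdots r_h\to_{wh}t\{x{\leftarrow}u\}\,r_1\cdots r_h$ ($h\ge0$). A sequence is complete if it ends on a normal term. **Naive KAM.** Environments $e::=\epsilon\mid[x{\leftarrow}c]\cdot e$, closures $c=(t,e)$, stacks $\pi::=\epsilon\mid c\cdot\pi$; states are triples $(t,e,\pi)$ with an immutable closed code $t_0$; $e(x)$ is the closure of the first entry for $x$ in $e$. The initial state for closed $t_0$ is $(t_0,\epsilon,\epsilon)$. Transitions: - $(t\,u,e,\pi)\to(t,e,(u,e)\cdot\pi)$; - $(\lambda x.t,e,c\cdot\pi)\to(t,[x{\leftarrow}c]\cdot e,\pi)$; - $(x,e,\pi)\to(u,e',\pi)$ if $e(x)=(u,e')$. $\sigma_n$ simulates $\rho_n$ when it is the complete run from the initial state for $t_n$. **Costs.** Each term occurrence in a state is a pointer to the code, of size $\log|t_0|$ (likewise for variables of environment entries). Environments, closures and stacks are flat strings (no sharing, no pointers between them), so the space of a state is the sum of the costs of its components (code not counted); $|\sigma|_{\mathsf{sp}}$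 is the maximum space of a state of $\sigma$. Each transition has time cost polynomial in the size of its whole source state (data structures are copied and rewritten as strings, so manipulating a state of size $s$ costs at least the space it occupies); $|\sigma|_{\mathsf{tm}}$ is the sum of the time costs of the transitions. -}

module Defs where

open import Data.Fin using (Fin)
open import Data.Fin.Substitution using (Sub; Lift; TermSubst)
open import Data.List using (List; []; _∷_; foldl)
open import Data.Nat using (ℕ; suc; _+_; _*_; _^_; _⊔_; _≤_; _≥_; _>_)
open import Data.Nat.Logarithm using (⌈log₂_⌉)
open import Data.Product using (∃-syntax; _×_)
open import Data.Vec using (Vec; []; _∷_; lookup)
open import Level using (0ℓ)
open import Relation.Binary.Core using (Rel)
open import Relation.Binary.Construct.Closure.ReflexiveTransitive using (Star; ε; _◅_)
open import Relation.Binary.PropositionalEquality using (_≡_)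
open import Relation.Binary.Rewriting using (IsNormalForm)

-- λ-terms up to α-equivalence, as de Bruijn terms with free variables
-- in Fin m; closed terms are the inhabitants of Term 0.

infixl 9 _·_

data Term (m : ℕ) : Set where
  var : Fin m → Term m
  ƛ   : Term (suc m) → Term m
  _·_ : Term m → Term m → Term m

∣_∣ᵗ : ∀ {m} → Term m → ℕ
∣ var x ∣ᵗ = 1
∣ ƛ t ∣ᵗ   = suc ∣ t ∣ᵗ
∣ t · u ∣ᵗ = suc (∣ t ∣ᵗ + ∣ u ∣ᵗ)

module _ {T : ℕ → Set} (l : Lift T Term) where
  open Lift l using (_↑; lift)

  applySub : ∀ {m n} → Term m → Sub T m n → Term n
  applySub (var x) ρ = lift (lookup ρ x)
  applySub (ƛ t)   ρ = ƛ (applySub t (ρ ↑))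
  applySub (t · u) ρ = applySub t ρ · applySub u ρ

termSubst : TermSubst Term
termSubst = record { var = var ; app = applySub }

open TermSubst termSubst using (_/_; sub)

-- Capture-avoiding substitution of u for the variable of index 0.

_[_] : ∀ {m} → Term (suc m) → Term m → Term m
t [ u ] = t / sub u

infix 4 _→wh_ _→wh*_ _⟶_ _⟶*_

-- foldl _·_ t (r₁ ∷ … ∷ rₕ ∷ []) is t r₁ ⋯ rₕ.

data _→wh_ {m : ℕ} : Rel (Term m) 0ℓ where
  β : ∀ t u rs → foldl _·_ ((ƛ t) · u) rs →wh foldl _·_ (t [ u ]) rs

_→wh*_ : ∀ {m} → Rel (Term m) 0ℓ
_→wh*_ = Star _→wh_

length : ∀ {A : Set} {R : Rel A 0ℓ} {a b : A} → Star R a b → ℕ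
length ε       = 0
length (_ ◅ ρ) = suc (length ρ)

Complete : ∀ {A : Set} {R : Rel A 0ℓ} {a b : A} → Star R a b → Set
Complete {R = R} {b = b} _ = IsNormalForm R b

-- A term with free variables in Fin m is paired with an environment having
-- one entry for each of them, the most recent first.  The first entry for
-- the variable of index x is then the one at position x, so that entries
-- need not record their variable (whose cost is nevertheless counted below).

data Closure : Set where
  ⟨_,_⟩ : ∀ {m} → Term m → Vec Closure m → Closure

Env : ℕ → Set
Env = Vec Closure

Stack : Set
Stack = List Closure

-- The immutable code is not modified by transitions; it is a parameter of
-- the cost measures, the only place where it matters.

data State : Set where
  ⟨_,_,_⟩ : ∀ {m} → Term m → Env m → Stack → State

initial : Term 0 → State
initial t₀ = ⟨ t₀ , [] , [] ⟩

data _⟶_ : Rel State 0ℓ where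
  push  : ∀ {m} {t u : Term m} {e π} →
          ⟨ t · u , e , π ⟩ ⟶ ⟨ t , e , ⟨ u , e ⟩ ∷ π ⟩
  bind  : ∀ {m} {t : Term (suc m)} {e : Env m} {c π} →
          ⟨ ƛ t , e , c ∷ π ⟩ ⟶ ⟨ t , c ∷ e , π ⟩
  fetch : ∀ {m k} {x : Fin m} {e : Env m} {u : Term k} {e′ : Env k} {π} →
          lookup e x ≡ ⟨ u , e′ ⟩ →
          ⟨ var x , e , π ⟩ ⟶ ⟨ u , e′ , π ⟩

_⟶*_ : Rel State 0ℓ
_⟶*_ = Star _⟶_

Simulates : ∀ {s s′ : State} {t u : Term 0} → s ⟶* s′ → t →wh* u → Set
Simulates {s} {t = t} σ ρ = s ≡ initial t × Complete σ

pointer : Term 0 → ℕ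
pointer t₀ = ⌈log₂ ∣ t₀ ∣ᵗ ⌉

module _ (t₀ : Term 0) where

  mutual
    closureSpace : Closure → ℕ
    closureSpace ⟨ t , e ⟩ = pointer t₀ + envSpace e

    -- The pointer counted for an entry is the one for its variable.
    envSpace : ∀ {m} → Env m → ℕ
    envSpace []      = 0
    envSpace (c ∷ e) = pointer t₀ + closureSpace c + envSpace e

  stackSpace : Stack → ℕ
  stackSpace []      = 0
  stackSpace (c ∷ π) = closureSpace c + stackSpace π

  stateSpace : State → ℕ
  stateSpace ⟨ t , e , π ⟩ = pointer t₀ + envSpace e + stackSpace π

  runSpace : ∀ {s s′} → s ⟶* s′ → ℕ
  runSpace (ε {x = s})       = stateSpace s
  runSpace (_◅_ {i = s} _ σ) = stateSpace s ⊔ runSpace σ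

-- The time cost of a transition is not a fixed function: it is any quantity
-- that is at least the space of the source state and bounded by a polynomial
-- in it, uniformly in the code t₀.

record TimeModel : Set where
  field
    cost        : (t₀ : Term 0) {s s′ : State} → s ⟶ s′ → ℕ
    coefficient : ℕ
    degree      : ℕ
    space≤cost  : ∀ t₀ {s s′} (τ : s ⟶ s′) → stateSpace t₀ s ≤ cost t₀ τ
    cost≤poly   : ∀ t₀ {s s′} (τ : s ⟶ s′) →
                  cost t₀ τ ≤ coefficient * suc (stateSpace t₀ s) ^ degree

runTime : TimeModel → (t₀ : Term 0) → ∀ {s s′} → s ⟶* s′ → ℕ
runTime M t₀ ε       = 0
runTime M t₀ (τ ◅ σ) = TimeModel.cost M t₀ τ + runTime M t₀ σ

-- Ω g f means f(n) = Ω(g(n)): eventually g(n) / c ≤ f(n), with c > 0 multiplied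
-- out to stay in ℕ.

Ω : (ℕ → ℕ) → (ℕ → ℕ) → Set
Ω g f = ∃[ c ] ∃[ N ] c > 0 × (∀ n → n ≥ N → g n ≤ c * f n)

{-# OPTIONS --safe #-}
-- Take tₙ = (λ. (λ. ⋯ (λ. I) I ⋯) I) I with n redexes.  The machine saves the
-- current environment in the closure of each argument I, although I is closed,
-- and then adds that closure to the very same environment.  As nothing is
-- shared, every β-step doubles the environment.
module Submission where

open import Defs
open import Data.Fin using (zero)
open import Data.Fin.Substitution using (Sub; TermSubst)
open import Data.List using ([]; _∷_; foldl)
open import Data.Nat using (ℕ; zero; suc; _+_; _*_; _^_; _≤_; _≥_; z≤n; s≤s)
open import Data.Nat.Logarithm using (⌈log₂⌉-mono-≤)
open import Data.Nat.Properties
open import Data.Nat.Tactic.RingSolver using (solve-∀)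
open import Data.Product using (Σ-syntax; _×_; _,_)
open import Data.Vec using ([]; _∷_)
open import Relation.Binary.Construct.Closure.ReflexiveTransitive using (ε; _◅_)
open import Relation.Binary.PropositionalEquality
  using (_≡_; _≢_; refl; sym; cong; subst)
open import Relation.Binary.Rewriting using (IsNormalForm)

open TermSubst termSubst using (_/_)

I : ∀ {m} → Term m
I = ƛ (var zero)

-- Closed, yet generic in `m`, so that the body of each outer `ƛ`, which ignores its variable, is
-- again a member of the family.
redexes : ∀ {m} → ℕ → Term m
redexes zero    = I
redexes (suc n) = ƛ (redexes n) · I

-- Arbitrary `ρ` because passing under `ƛ` lifts it.
redexes-/ : ∀ n {m k} (ρ : Sub Term m k) → redexes n / ρ ≡ redexes n
redexes-/ zero    ρ = refl
redexes-/ (suc n) ρ = cong (λ t → ƛ t · I) (redexes-/ n _)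

reduction : ∀ n {m} → redexes {m} n →wh* I
reduction zero    = ε
reduction (suc n) =
  subst (redexes (suc n) →wh_) (redexes-/ n _) (β (redexes n) I []) ◅ reduction n

length-reduction : ∀ n {m} → length (reduction n {m}) ≡ n
length-reduction zero    = refl
length-reduction (suc n) = cong suc (length-reduction n)

-- The source index of `β` is a `foldl`, stuck for unknown `rs`. Absorbing the arguments one by one
-- into the head keeps it an application.
spine≢ƛ : ∀ {m} (t u : Term m) rs {s} → foldl _·_ (t · u) rs ≢ ƛ s
spine≢ƛ t u []       ()
spine≢ƛ t u (r ∷ rs) = spine≢ƛ (t · u) r rs

redex≢ƛ : ∀ {m} {t t′ : Term m} {s} → t →wh t′ → t ≢ ƛ s
redex≢ƛ (β t u rs) = spine≢ƛ (ƛ t) u rs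

ƛ-normal : ∀ {m} (s : Term (suc m)) → IsNormalForm _→wh_ (ƛ s)
ƛ-normal s (_ , r) = redex≢ƛ r refl

grow : ∀ {m} → Env m → Env (suc m)
grow e = ⟨ I , e ⟩ ∷ e

-- Each `bind` consumes the closure just pushed, so the run halts at an abstraction facing an empty
-- stack.
final : (n : ℕ) → ∀ {m} → Env m → State
final zero    e = ⟨_,_,_⟩ I e []
final (suc n) e = final n (grow e)

run : ∀ (n : ℕ) {m} (e : Env m) → ⟨_,_,_⟩ (redexes n) e [] ⟶* final n e
run zero    e = ε
run (suc n) e = push ◅ bind ◅ run n (grow e)

final-normal : ∀ n {m} (e : Env m) → IsNormalForm _⟶_ (final n e)
final-normal zero    e (_ , ())
final-normal (suc n) e = final-normal n (grow e)

2≤∣redexes∣ : ∀ n {m} → 2 ≤ ∣ redexes {m} n ∣ᵗ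
2≤∣redexes∣ zero    = ≤-refl
2≤∣redexes∣ (suc n) = s≤s (s≤s z≤n)

-- Doubling needs a positive start; in a code of size 1 pointers would have size 0.
1≤pointer : ∀ n → 1 ≤ pointer (redexes n)
1≤pointer n = ⌈log₂⌉-mono-≤ (2≤∣redexes∣ n)

module _ (t₀ : Term 0) where

  -- The pointer is included because the initial environment has space 0, from which doubling alone
  -- yields nothing.
  focusSpace : ∀ {m} → Env m → ℕ
  focusSpace e = pointer t₀ + envSpace t₀ e

  -- The two copies of `e` are paired with the focus pointer and the code pointer of the new
  -- closure; the pointer for the entry's variable is slack.
  focusSpace-grow : ∀ {m} (e : Env m) → 2 * focusSpace e ≤ focusSpace (grow e)
  focusSpace-grow e = begin
    2 * (p + q)                 ≤⟨ m≤m+n _ p ⟩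
    2 * (p + q) + p             ≡⟨ rearrange p q ⟩
    p + (p + (p + q) + q)       ∎
    where
    open ≤-Reasoning
    p = pointer t₀
    q = envSpace t₀ e
    rearrange : ∀ p q → 2 * (p + q) + p ≡ p + (p + (p + q) + q)
    rearrange = solve-∀

  -- The inductive step shared by the space and time bounds: one factor 2 is traded for one `grow`.
  2^suc-focusSpace : ∀ n {m} (e : Env m) →
    2 ^ suc n * focusSpace e ≤ 2 ^ n * focusSpace (grow e)
  2^suc-focusSpace n e = begin
    2 * 2 ^ n * focusSpace e    ≡⟨ cong (_* focusSpace e) (*-comm 2 (2 ^ n)) ⟩
    2 ^ n * 2 * focusSpace e    ≡⟨ *-assoc (2 ^ n) 2 _ ⟩
    2 ^ n * (2 * focusSpace e)  ≤⟨ *-monoʳ-≤ (2 ^ n) (focusSpace-grow e) ⟩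
    2 ^ n * focusSpace (grow e) ∎
    where open ≤-Reasoning

  runSpace-◅ : ∀ {a b c} (τ : a ⟶ b) (σ : b ⟶* c) →
    runSpace t₀ σ ≤ runSpace t₀ (τ ◅ σ)
  runSpace-◅ {a} τ σ = m≤n⊔m (stateSpace t₀ a) (runSpace t₀ σ)

  -- The final state alone attains the bound. `t₀` stays fixed while the induction descends into its
  -- subterms.
  runSpace-run : ∀ n {m} (e : Env m) → 2 ^ n * focusSpace e ≤ runSpace t₀ (run n e)
  runSpace-run zero    e = ≤-refl
  runSpace-run (suc n) e = begin
    2 ^ suc n * focusSpace e                     ≤⟨ 2^suc-focusSpace n e ⟩
    2 ^ n * focusSpace (grow e)                  ≤⟨ runSpace-run n (grow e) ⟩
    runSpace t₀ (run n (grow e))                 ≤⟨ runSpace-◅ bind (run n (grow e)) ⟩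
    runSpace t₀ (bind ◅ run n (grow e))          ≤⟨ runSpace-◅ push (bind ◅ run n (grow e)) ⟩
    runSpace t₀ (run (suc n) e)                  ∎
    where open ≤-Reasoning

  module _ (M : TimeModel) where
    open TimeModel M

    runTime-◅ : ∀ {a b c} (τ : a ⟶ b) (σ : b ⟶* c) →
      runTime M t₀ σ ≤ runTime M t₀ (τ ◅ σ)
    runTime-◅ τ σ = m≤n+m (runTime M t₀ σ) (cost t₀ τ)

    -- The source of the last bind already holds two copies of the environment,
    -- one of them on the stack.
    runTime-run : ∀ n {m} (e : Env m) →
      2 ^ suc n * focusSpace e ≤ runTime M t₀ (run (suc n) e)
    runTime-run zero {m} e = begin
      2 * focusSpace e                      ≡⟨⟩
      focusSpace e + (focusSpace e + 0)     ≤⟨ space≤cost t₀ τ ⟩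
      cost t₀ τ                             ≤⟨ m≤m+n _ 0 ⟩
      runTime M t₀ (τ ◅ ε)                  ≤⟨ runTime-◅ push (τ ◅ ε) ⟩
      runTime M t₀ (run 1 e)                ∎
      where
      open ≤-Reasoning
      τ : ⟨_,_,_⟩ (ƛ I) e (⟨ I , e ⟩ ∷ []) ⟶ ⟨_,_,_⟩ I (grow e) []
      τ = bind
    runTime-run (suc n) e = begin
      2 ^ suc (suc n) * focusSpace e                   ≤⟨ 2^suc-focusSpace (suc n) e ⟩
      2 ^ suc n * focusSpace (grow e)                  ≤⟨ runTime-run n (grow e) ⟩
      runTime M t₀ (run (suc n) (grow e))              ≤⟨ runTime-◅ bind (run (suc n) (grow e)) ⟩
      runTime M t₀ (bind ◅ run (suc n) (grow e))       ≤⟨ runTime-◅ push (bind ◅ run (suc n) (grow e)) ⟩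
      runTime M t₀ (run (suc (suc n)) e)               ∎
      where open ≤-Reasoning

2^n≤2^n*focusSpace : ∀ n → 2 ^ n ≤ 2 ^ n * focusSpace (redexes n) []
2^n≤2^n*focusSpace n = begin
  2 ^ n                               ≡⟨ *-identityʳ _ ⟨
  -- The `0` is the space of the empty environment.
  2 ^ n * 1                           ≤⟨ *-monoʳ-≤ (2 ^ n) (m≤n⇒m≤n+o 0 (1≤pointer n)) ⟩
  2 ^ n * focusSpace (redexes n) []   ∎
  where open ≤-Reasoning

Ω-from-≤ : ∀ {f g : ℕ → ℕ} N → (∀ n → n ≥ N → g n ≤ f n) → Ω g f
Ω-from-≤ N g≤f =
  1 , N , ≤-refl , λ n n≥N → ≤-trans (g≤f n n≥N) (≤-reflexive (sym (*-identityˡ _)))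

proposition10p8 : Σ[ t ∈ (ℕ → Term 0) ]
    Σ[ u ∈ (ℕ → Term 0) ]
    Σ[ ρ ∈ (∀ n → t n →wh* u n) ]
    Σ[ s ∈ (ℕ → State) ]
    Σ[ σ ∈ (∀ n → initial (t n) ⟶* s n) ]
    (∀ n → length (ρ n) ≡ n × Complete (ρ n) × Simulates (σ n) (ρ n))
    × Ω (λ n → 2 ^ n) (λ n → runSpace (t n) (σ n))
    × (∀ (M : TimeModel) → Ω (λ n → 2 ^ n) (λ n → runTime M (t n) (σ n)))
proposition10p8 =
  redexes ,
  (λ _ → I) ,
  (λ n → reduction n) ,
  (λ n → final n []) ,
  (λ n → run n []) ,
  (λ n → length-reduction n , ƛ-normal _ , refl , final-normal n []) ,
  Ω-from-≤ 0 (λ n _ → ≤-trans (2^n≤2^n*focusSpace n) (runSpace-run (redexes n) n [])) ,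
  -- The threshold is 1 because the run from `redexes 0` has no transition, hence time 0.
  λ M → Ω-from-≤ 1 λ where
    (suc n) _ → ≤-trans (2^n≤2^n*focusSpace (suc n)) (runTime-run (redexes (suc n)) M n [])
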